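{- Suppose that $A\neq B$ are strictly tree coloring equivalent $m\times m$ coloring matrices. Then there is a finite sequence $A=C_0,C_1,\dots,C_r=B$ with $r\ge1$ such that each $C_{s}$ is obtained from $C_{s-1}$ by one application of the following operation: given a coloring matrix $C=(c_{pq})$, disjoint sets $I,J\subseteq\{1,\dots,m\}$ with $|I|=|J|$ such that $\sum_{i\in I}t_C^{(i)}(n)=\sum_{j\in J}t_C^{(j)}(n)$ for all $n$, and a color $\ell$ with $c_{\ell i}=0$ for all $i\in I$ and $c_{\ell j}=1$ for all $j\in J$, replace $C$ by the matrix $C'$ that agrees with $C$ except that $c'_{\ell i}=1$ for $i\in I$ and $c'_{\ell j}=0$ for $j\in J$.
   Context: A plane tree is an unlabeled rooted tree in which the children of every vertex are linearly ordered. A coloring matrix is an $m\times m$ matrix $A=(a_{ij})$ with entries in $\{0,1\}$. An $A$-coloring of a plane tree assigns to each vertex a color in $\{1,\dots,m\}$ such that whenever a vertex of color $j$ is a child of a vertex of color $i$, $a_{ij}=1$. Let $t_A^{(i)}(n)$ be the number of pairs (plane tree with $n$ vertices, $A$-coloring of it) in which the root has color $i$. Two $m\times m$ coloring matrices $A,B$ are strictly tree coloring equivalent if $t_A^{(i)}(n)=t_B^{(i)}(n)$ for all $n\ge1$ and all $1\le i\le m$. -}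

module Defs where

open import Data.Bool using (Bool; true; false)
open import Data.Bool.Properties using () renaming (_≟_ to _≟ᵇ_)
open import Data.Fin using (Fin; zero; suc)
open import Data.Fin.Properties using (0↔⊥; 1↔⊤; +↔⊎)
open import Data.Fin.Subset using (Subset; _∈_; _∉_; _∩_; Empty; ∣_∣)
open import Data.Fin.Subset.Properties using (_∈?_)
open import Data.List using (List; []; _∷_; map; filter; allFin)
open import Data.List.Relation.Unary.All using (All; []; _∷_)
open import Data.Nat using (ℕ; zero; suc; _+_; _≤_; _<_; s≤s)
open import Data.Nat.Induction using (<-rec)
open import Data.Nat.ListAction using (sum)
open import Data.Nat.Properties using (m≤m+n; m≤n+m)
open import Data.Product using (Σ; _×_; _,_; proj₁; proj₂; Σ-syntax; ∃-syntax)
open import Data.Product.Function.Dependent.Propositional using (Σ-↔)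
open import Data.Sum using (_⊎_; inj₁; inj₂)
open import Data.Sum.Function.Propositional using (_⊎-↔_)
open import Data.Unit using (⊤; tt)
open import Data.Vec using (Vec; lookup)
open import Function.Bundles using (_↔_; mk↔ₛ′)
open import Function.Properties.Inverse using (↔-refl; ↔-trans)
open import Relation.Binary.PropositionalEquality using (_≡_; _≢_; refl)
open import Relation.Nullary using (yes; no; contradiction)

data PlaneTree : Set where
  node : List PlaneTree → PlaneTree

mutual
  size : PlaneTree → ℕ
  size (node ts) = suc (sizes ts)

  sizes : List PlaneTree → ℕ
  sizes []       = 0
  sizes (t ∷ ts) = size t + sizes ts

-- false and true stand for the entries 0 and 1.
ColoringMatrix : ℕ → Set
ColoringMatrix m = Vec (Vec Bool m) m

entry : ∀ {m} → ColoringMatrix m → Fin m → Fin m → Bool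
entry A i j = lookup (lookup A i) j

-- An arbitrary assignment of one of m colors to each vertex of a tree; it is
-- first-order data, so that _≡_ is equality of colorings.
data Coloring (m : ℕ) : PlaneTree → Set where
  node : ∀ {ts} → Fin m → All (Coloring m) ts → Coloring m (node ts)

rootColor : ∀ {m t} → Coloring m t → Fin m
rootColor (node i _) = i

mutual
  IsAColoring : ∀ {m} → ColoringMatrix m → ∀ {t} → Coloring m t → Set
  IsAColoring A (node i cs) = AreChildrenOf A i cs

  AreChildrenOf : ∀ {m} → ColoringMatrix m → Fin m → ∀ {ts} → All (Coloring m) ts → Set
  AreChildrenOf A i []       = ⊤
  AreChildrenOf A i (c ∷ cs) =
    entry A i (rootColor c) ≡ true × IsAColoring A c × AreChildrenOf A i cs

ColoredTree : ∀ {m} → ColoringMatrix m → Fin m → ℕ → Set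
ColoredTree {m} A i n =
  Σ[ t ∈ PlaneTree ] Σ[ c ∈ Coloring m t ]
    (size t ≡ n × rootColor c ≡ i × IsAColoring A c)

Finite : Set → Set
Finite X = ∃[ k ] (Fin k ↔ X)

finite-↔ : ∀ {X Y} → X ↔ Y → Finite X → Finite Y
finite-↔ e (k , f) = k , ↔-trans f e

finite-Fin : ∀ {n} → Finite (Fin n)
finite-Fin {n} = n , ↔-refl

finite-⊎ : ∀ {X Y} → Finite X → Finite Y → Finite (X ⊎ Y)
finite-⊎ (k , f) (l , g) = k + l , ↔-trans +↔⊎ (f ⊎-↔ g)

finite-ΣFin : ∀ {n} {P : Fin n → Set} → (∀ x → Finite (P x)) → Finite (Σ (Fin n) P)
finite-ΣFin {zero}      _ = 0 , mk↔ₛ′ (λ ()) (λ ()) (λ ()) (λ ())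
finite-ΣFin {suc n} {P} f =
  finite-↔
    (mk↔ₛ′
      (λ { (inj₁ p) → zero , p ; (inj₂ (x , p)) → suc x , p })
      (λ { (zero , p) → inj₁ p ; (suc x , p) → inj₂ (x , p) })
      (λ { (zero , p) → refl ; (suc x , p) → refl })
      (λ { (inj₁ p) → refl ; (inj₂ (x , p)) → refl }))
    (finite-⊎ (f zero) (finite-ΣFin (λ x → f (suc x))))

finite-Σ : ∀ {X} {P : X → Set} → Finite X → (∀ x → Finite (P x)) → Finite (Σ X P)
finite-Σ (k , e) f = finite-↔ (Σ-↔ e ↔-refl) (finite-ΣFin (λ x → f _))

finite-× : ∀ {X Y} → Finite X → Finite Y → Finite (X × Y)
finite-× f g = finite-Σ f (λ _ → g)

finite-≡ᵇ : ∀ (x y : Bool) → Finite (x ≡ y)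
finite-≡ᵇ x y with x ≟ᵇ y
... | yes refl = 1 , ↔-trans 1↔⊤ (mk↔ₛ′ (λ _ → refl) (λ _ → tt) (λ { refl → refl }) (λ _ → refl))
... | no ¬p    = 0 , mk↔ₛ′ (λ ()) (λ p → contradiction p ¬p) (λ p → contradiction p ¬p) (λ ())

Split : ℕ → Set
Split k = Σ[ a ∈ ℕ ] Σ[ b ∈ ℕ ] a + b ≡ k

finite-Split : ∀ k → Finite (Split k)
finite-Split zero    = 1 , ↔-trans 1↔⊤
  (mk↔ₛ′ (λ _ → 0 , 0 , refl) (λ _ → tt) (λ { (zero , .0 , refl) → refl }) (λ _ → refl))
finite-Split (suc k) =
  finite-↔
    (mk↔ₛ′
      (λ { (inj₁ tt) → 0 , suc k , refl ; (inj₂ (a , b , refl)) → suc a , b , refl })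
      (λ { (zero , b , _) → inj₁ tt ; (suc a , b , refl) → inj₂ (a , b , refl) })
      (λ { (zero , .(suc k) , refl) → refl ; (suc a , b , refl) → refl })
      (λ { (inj₁ tt) → refl ; (inj₂ (a , b , refl)) → refl }))
    (finite-⊎ (1 , 1↔⊤) (finite-Split k))

-- The sequences of A-colored trees, with k vertices altogether, that can be
-- attached below a vertex of color i.
ColoredForest : ∀ {m} → ColoringMatrix m → Fin m → ℕ → Set
ColoredForest {m} A i k =
  Σ[ ts ∈ List PlaneTree ] Σ[ cs ∈ All (Coloring m) ts ]
    (sizes ts ≡ k × AreChildrenOf A i cs)

tree↔forest : ∀ {m} (A : ColoringMatrix m) i k → ColoredForest A i k ↔ ColoredTree A i (suc k)
tree↔forest A i k = mk↔ₛ′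
  (λ { (ts , cs , refl , p) → node ts , node i cs , refl , refl , p })
  (λ { (node ts , node .i cs , refl , refl , p) → ts , cs , refl , p })
  (λ { (node ts , node .i cs , refl , refl , p) → refl })
  (λ { (ts , cs , refl , p) → refl })

forest-zero : ∀ {m} (A : ColoringMatrix m) i → ⊤ ↔ ColoredForest A i 0
forest-zero A i = mk↔ₛ′
  (λ _ → [] , [] , refl , tt)
  (λ _ → tt)
  (λ { ([] , [] , refl , tt) → refl ; (node _ ∷ _ , _ , () , _) })
  (λ _ → refl)

forest-suc : ∀ {m} (A : ColoringMatrix m) i k →
  (Σ[ s ∈ Split k ] Σ[ j ∈ Fin m ]
    (entry A i j ≡ true × ColoredForest A j (proj₁ s) × ColoredForest A i (proj₁ (proj₂ s))))
  ↔ ColoredForest A i (suc k)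
forest-suc A i k = mk↔ₛ′
  (λ { ((_ , _ , refl) , j , e , (us , ds , refl , p) , (ts , cs , refl , q)) →
       node us ∷ ts , node j ds ∷ cs , refl , e , p , q })
  (λ { (node us ∷ ts , node j ds ∷ cs , refl , e , p , q) →
       (_ , _ , refl) , j , e , (us , ds , refl , p) , (ts , cs , refl , q) })
  (λ { (node us ∷ ts , node j ds ∷ cs , refl , e , p , q) → refl })
  (λ { ((_ , _ , refl) , j , e , (us , ds , refl , p) , (ts , cs , refl , q)) → refl })

finite-ColoredForest : ∀ {m} (A : ColoringMatrix m) k i → Finite (ColoredForest A i k)
finite-ColoredForest A = <-rec (λ k → ∀ i → Finite (ColoredForest A i k)) step
  where
  step : ∀ k → (∀ {l} → l < k → ∀ i → Finite (ColoredForest A i l)) →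
         ∀ i → Finite (ColoredForest A i k)
  step zero    rec i = finite-↔ (forest-zero A i) (1 , 1↔⊤)
  step (suc k) rec i = finite-↔ (forest-suc A i k)
    (finite-Σ (finite-Split k) λ { (a , b , refl) →
      finite-Σ finite-Fin λ j →
        finite-× (finite-≡ᵇ (entry A i j) true)
          (finite-× (rec (s≤s (m≤m+n a b)) j) (rec (s≤s (m≤n+m b a)) i)) })

finite-ColoredTree : ∀ {m} (A : ColoringMatrix m) i n → Finite (ColoredTree A i n)
finite-ColoredTree A i zero    = 0 , ↔-trans 0↔⊥
  (mk↔ₛ′ (λ ()) (λ { (node _ , _ , () , _) }) (λ { (node _ , _ , () , _) }) (λ ()))
finite-ColoredTree A i (suc k) = finite-↔ (tree↔forest A i k) (finite-ColoredForest A k i)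

-- The cardinality of ColoredTree A i n; it does not depend on the particular
-- bijection with Fin provided by finite-ColoredTree.
t : ∀ {m} → ColoringMatrix m → Fin m → ℕ → ℕ
t A i n = proj₁ (finite-ColoredTree A i n)

StrictlyTreeColoringEquivalent : ∀ {m} → ColoringMatrix m → ColoringMatrix m → Set
StrictlyTreeColoringEquivalent A B = ∀ n → 1 ≤ n → ∀ i → t A i n ≡ t B i n

sumOver : ∀ {m} → Subset m → (Fin m → ℕ) → ℕ
sumOver {m} I f = sum (map f (filter (_∈? I) (allFin m)))

record Operation {m : ℕ} (C C′ : ColoringMatrix m) : Set where
  field
    I J      : Subset m
    disjoint : Empty (I ∩ J)
    ∣I∣≡∣J∣  : ∣ I ∣ ≡ ∣ J ∣
    sums     : ∀ n → sumOver I (λ i → t C i n) ≡ sumOver J (λ j → t C j n)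
    ℓ        : Fin m
    C-on-I   : ∀ i → i ∈ I → entry C ℓ i ≡ false
    C-on-J   : ∀ j → j ∈ J → entry C ℓ j ≡ true
    C′-on-I  : ∀ i → i ∈ I → entry C′ ℓ i ≡ true
    C′-on-J  : ∀ j → j ∈ J → entry C′ ℓ j ≡ false
    other-rows    : ∀ p q → p ≢ ℓ → entry C′ p q ≡ entry C p q
    other-columns : ∀ q → q ∉ I → q ∉ J → entry C′ ℓ q ≡ entry C ℓ q

{-# OPTIONS --safe #-}

-- Let T_i be the generating function of t A i. Splitting off the first subtree of the root gives
-- T_i = x + (Σ_j a_ij T_j) T_i, so T_i determines Σ_j a_ij T_j because T_i ≠ 0. Hence if A and B
-- are equivalent, their i-th rows select subfamilies of the T_j with the same sum, for every i.
-- Conversely this system of equations determines the T_i, so every matrix whose rows are each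
-- taken from A or from B is equivalent to A. Replacing the rows of A by those of B one at a time
-- therefore stays inside the equivalence class, and replacing row ℓ is an operation with
-- I = B_ℓ ∖ A_ℓ and J = A_ℓ ∖ B_ℓ; |I| = |J| is the case n = 1, since t A i 1 = 1.
module Submission where

open import Defs
open import Data.Nat using (ℕ; suc; _≤_)
open import Data.Fin using (Fin; zero; suc; inject₁; fromℕ)
open import Data.Product using (_×_; ∃-syntax; Σ-syntax)
open import Relation.Binary.PropositionalEquality using (_≡_; _≢_)

open import Data.Bool using (Bool; true; false; if_then_else_)
open import Data.Bool.Properties using (¬-not)
open import Data.Fin using (toℕ)
open import Data.Fin.Properties using (1↔⊤; +↔⊎; *↔×; toℕ<n; toℕ-fromℕ; toℕ-inject₁; toℕ-injective; cantor-schröder-bernstein)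
open import Data.Fin.Subset using (Subset; _∈_; _∉_; _⊆_; _∩_; _∪_; ∁; ∣_∣)
open import Data.Fin.Subset.Properties using (_∈?_; x∈p∩q⁺; x∈p∩q⁻; x∈∁p⇒x∉p; x∉p⇒x∈∁p; ∪-comm)
open import Data.List as List using (List; []; _∷_; map; filter; allFin)
open import Data.List.Properties using (map-cong; map-tabulate)
open import Data.Nat using (zero; _+_; _*_; _<_; _<?_; z≤n; s≤s)
open import Data.Nat.Induction using (<-rec)
open import Data.Nat.ListAction using (sum)
open import Data.Nat.Properties using (≤-refl; ≤∧≢⇒<; ≤⇒≯; ≮⇒≥; m<n⇒m<1+n; m≤n⇒m≤1+n; +-assoc; +-cancelˡ-≡; *-identityʳ; +-commutativeSemigroup)
open import Algebra.Properties.CommutativeSemigroup +-commutativeSemigroup using (x∙yz≈y∙xz)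
open import Data.Product using (_,_; proj₁; proj₂)
open import Data.Product.Function.NonDependent.Propositional using (_×-↔_)
open import Data.Sum using (_⊎_; inj₁; inj₂)
open import Data.Sum.Function.Propositional using (_⊎-↔_)
open import Data.Vec using ([]; _∷_; lookup; tabulate)
open import Data.Vec.Properties using (lookup⇒[]=; []=⇒lookup; lookup∘tabulate; tabulate∘lookup; tabulate-cong)
open import Function using (_∘_)
open import Function.Bundles using (_↔_; mk↔ₛ′; module Inverse)
open import Function.Properties.Inverse using (↔-sym; ↔-trans)
open import Relation.Binary.PropositionalEquality using (refl; sym; trans; cong; cong₂; subst; module ≡-Reasoning)
open import Relation.Nullary using (yes; no; does; contradiction)
open import Relation.Nullary.Decidable using (dec-true; dec-false)

-- Sums over subsets

-- `sumOver` is defined through `filter`; this supplies the recursion on the subset that the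
-- inductions below need.
sumOver-∷ : ∀ {m} b (p : Subset m) f →
  sumOver (b ∷ p) f ≡ (if b then f zero else 0) + sumOver p (f ∘ suc)
sumOver-∷ {m} b p f = trans (head b) (cong ((if b then f zero else 0) +_)
  (trans (cong (selected b) (sym (map-tabulate (λ i → i) suc))) (shift (allFin m))))
  where
  selected : Bool → List (Fin (suc m)) → ℕ
  selected b xs = sum (map f (filter (_∈? (b ∷ p)) xs))

  head : ∀ b → sumOver (b ∷ p) f ≡ (if b then f zero else 0) + selected b (List.tabulate suc)
  head true  = refl
  head false = refl

  shift : ∀ xs → selected b (map suc xs) ≡ sum (map (f ∘ suc) (filter (_∈? p) xs))
  shift []       = refl
  shift (x ∷ xs) with x ∈? p
  ... | yes _ = cong (f (suc x) +_) (shift xs)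
  ... | no  _ = shift xs

sumOver-cong : ∀ {m} (p : Subset m) {f g : Fin m → ℕ} → (∀ i → f i ≡ g i) → sumOver p f ≡ sumOver p g
sumOver-cong {m} p f≗g = cong sum (map-cong f≗g (filter (_∈? p) (allFin m)))

sumOver-const : ∀ {m} (p : Subset m) c → sumOver p (λ _ → c) ≡ ∣ p ∣ * c
sumOver-const []          c = refl
sumOver-const (true ∷ p)  c = trans (sumOver-∷ true p _) (cong (c +_) (sumOver-const p c))
sumOver-const (false ∷ p) c = trans (sumOver-∷ false p _) (sumOver-const p c)

-- Unlike the library's _─_, this computes on _∷_ to an instance of itself.
_∖_ : ∀ {m} → Subset m → Subset m → Subset m
p ∖ q = p ∩ ∁ q

-- `p ∪ q` is the disjoint union of `p` and `q ∖ p`.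
sumOver-∪-∖ : ∀ {m} (p q : Subset m) f → sumOver (p ∪ q) f ≡ sumOver p f + sumOver (q ∖ p) f
sumOver-∪-∖ []          []          f = refl
sumOver-∪-∖ (true ∷ p)  (true ∷ q)  f
  rewrite sumOver-∷ true (p ∪ q) f | sumOver-∷ true p f | sumOver-∷ false (q ∖ p) f
  = trans (cong (f zero +_) (sumOver-∪-∖ p q (f ∘ suc))) (sym (+-assoc (f zero) _ _))
sumOver-∪-∖ (true ∷ p)  (false ∷ q) f
  rewrite sumOver-∷ true (p ∪ q) f | sumOver-∷ true p f | sumOver-∷ false (q ∖ p) f
  = trans (cong (f zero +_) (sumOver-∪-∖ p q (f ∘ suc))) (sym (+-assoc (f zero) _ _))
sumOver-∪-∖ (false ∷ p) (true ∷ q)  f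
  rewrite sumOver-∷ true (p ∪ q) f | sumOver-∷ false p f | sumOver-∷ true (q ∖ p) f
  = trans (cong (f zero +_) (sumOver-∪-∖ p q (f ∘ suc))) (x∙yz≈y∙xz (f zero) (sumOver p (f ∘ suc)) _)
sumOver-∪-∖ (false ∷ p) (false ∷ q) f
  rewrite sumOver-∷ false (p ∪ q) f | sumOver-∷ false p f | sumOver-∷ false (q ∖ p) f
  = sumOver-∪-∖ p q (f ∘ suc)

-- Discards the common part of `p` and `q` without subtraction: adding the equal sums over `p` and
-- `q` turns both sides into the sum over `p ∪ q`.
sumOver-∖ : ∀ {m} (p q : Subset m) f → sumOver p f ≡ sumOver q f → sumOver (q ∖ p) f ≡ sumOver (p ∖ q) f
sumOver-∖ p q f eq = +-cancelˡ-≡ (sumOver p f) _ _ (begin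
  sumOver p f + sumOver (q ∖ p) f  ≡⟨ sumOver-∪-∖ p q f ⟨
  sumOver (p ∪ q) f                ≡⟨ cong (λ r → sumOver r f) (∪-comm p q) ⟩
  sumOver (q ∪ p) f                ≡⟨ sumOver-∪-∖ q p f ⟩
  sumOver q f + sumOver (p ∖ q) f  ≡⟨ cong (_+ sumOver (p ∖ q) f) eq ⟨
  sumOver p f + sumOver (p ∖ q) f  ∎)
  where open ≡-Reasoning

p∖q⊆p : ∀ {m} (p q : Subset m) → p ∖ q ⊆ p
p∖q⊆p p q x∈p∖q = proj₁ (x∈p∩q⁻ p (∁ q) x∈p∖q)

x∈p∖q⇒x∉q : ∀ {m x} (p q : Subset m) → x ∈ p ∖ q → x ∉ q
x∈p∖q⇒x∉q p q x∈p∖q = x∈∁p⇒x∉p (proj₂ (x∈p∩q⁻ p (∁ q) x∈p∖q))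

x∈p∧x∉q⇒x∈p∖q : ∀ {m x} {p q : Subset m} → x ∈ p → x ∉ q → x ∈ p ∖ q
x∈p∧x∉q⇒x∈p∖q x∈p x∉q = x∈p∩q⁺ (x∈p , x∉p⇒x∈∁p x∉q)

∉⇒lookup≡false : ∀ {m x} {p : Subset m} → x ∉ p → lookup p x ≡ false
∉⇒lookup≡false {x = x} {p} x∉p = ¬-not (x∉p ∘ lookup⇒[]= x p)

lookup-∖-agree : ∀ {m} (p q : Subset m) x → x ∉ q ∖ p → x ∉ p ∖ q → lookup q x ≡ lookup p x
lookup-∖-agree p q x ∉q∖p ∉p∖q with x ∈? p | x ∈? q
... | yes x∈p | yes x∈q = trans ([]=⇒lookup x∈q) (sym ([]=⇒lookup x∈p))
... | yes x∈p | no  x∉q = contradiction (x∈p∧x∉q⇒x∈p∖q x∈p x∉q) ∉p∖q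
... | no  x∉p | yes x∈q = contradiction (x∈p∧x∉q⇒x∈p∖q x∈q x∉p) ∉q∖p
... | no  x∉p | no  x∉q = trans (∉⇒lookup≡false x∉q) (sym (∉⇒lookup≡false x∉p))

-- Cauchy products

conv : (ℕ → ℕ) → (ℕ → ℕ) → ℕ → ℕ
conv f g zero    = f 0 * g 0
conv f g (suc k) = f 0 * g (suc k) + conv (f ∘ suc) g k

conv-cong : ∀ {f f′ g g′ : ℕ → ℕ} k → (∀ a → a ≤ k → f a ≡ f′ a) → (∀ b → b ≤ k → g b ≡ g′ b) →
  conv f g k ≡ conv f′ g′ k
conv-cong zero    f≗f′ g≗g′ = cong₂ _*_ (f≗f′ 0 z≤n) (g≗g′ 0 z≤n)
conv-cong (suc k) f≗f′ g≗g′ = cong₂ _+_ (cong₂ _*_ (f≗f′ 0 z≤n) (g≗g′ (suc k) ≤-refl))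
  (conv-cong k (λ a a≤k → f≗f′ (suc a) (s≤s a≤k)) (λ b b≤k → g≗g′ b (m≤n⇒m≤1+n b≤k)))

-- The summand containing `f k` has the factor `g 0`, which is 1; the others agree and are cancelled
-- from the front.
conv-cancelʳ-step : ∀ {f f′ g : ℕ → ℕ} → g 0 ≡ 1 → ∀ k → (∀ {a} → a < k → f a ≡ f′ a) →
  conv f g k ≡ conv f′ g k → f k ≡ f′ k
conv-cancelʳ-step {f} {f′} {g} g₀≡1 zero _ eq rewrite g₀≡1 =
  trans (sym (*-identityʳ (f 0))) (trans eq (*-identityʳ (f′ 0)))
conv-cancelʳ-step {f} {f′} {g} g₀≡1 (suc k) f≗f′ eq
  rewrite f≗f′ {0} (s≤s z≤n) =
  conv-cancelʳ-step g₀≡1 k (λ a<k → f≗f′ (s≤s a<k)) (+-cancelˡ-≡ (f′ 0 * g (suc k)) _ _ eq)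

-- Strong induction over the coefficients. With `g` the coefficients of T_i / x, this is
-- cancellation of T_i.
conv-cancelʳ : ∀ {f f′ g : ℕ → ℕ} → g 0 ≡ 1 → (∀ k → conv f g k ≡ conv f′ g k) → ∀ k → f k ≡ f′ k
conv-cancelʳ {f} {f′} g₀≡1 eq =
  <-rec (λ k → f k ≡ f′ k) (λ k rec → conv-cancelʳ-step g₀≡1 k rec (eq k))

-- Cardinalities

-- Turns bijections into equations for `t`, whatever enumeration `finite-ColoredForest` happens to
-- construct.
Fin↔-unique : ∀ {X : Set} {k l} → Fin k ↔ X → Fin l ↔ X → k ≡ l
Fin↔-unique f g = cantor-schröder-bernstein (injective (↔-trans f (↔-sym g))) (injective (↔-trans g (↔-sym f)))
  where
  injective : ∀ {k l} (e : Fin k ↔ Fin l) {x y} → Inverse.to e x ≡ Inverse.to e y → x ≡ y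
  injective e {x} {y} eq =
    trans (sym (Inverse.strictlyInverseʳ e x)) (trans (cong (Inverse.from e) eq) (Inverse.strictlyInverseʳ e y))

-- Membership is written with `lookup` so that, for `p` a row of `A`, it is by definition the
-- condition `entry A i j ≡ true` of `forest-suc`.
card-∈ : ∀ {m} (p : Subset m) {P : Fin m → Set} {f : Fin m → ℕ} → (∀ j → Fin (f j) ↔ P j) →
  Fin (sumOver p f) ↔ (Σ[ j ∈ Fin m ] (lookup p j ≡ true × P j))
card-∈ []          e = mk↔ₛ′ (λ ()) (λ ()) (λ ()) (λ ())
card-∈ (true ∷ p)  {f = f} e rewrite sumOver-∷ true p f =
  ↔-trans (↔-trans +↔⊎ (e zero ⊎-↔ card-∈ p (e ∘ suc))) (mk↔ₛ′
    (λ { (inj₁ x) → zero , refl , x ; (inj₂ (j , q , x)) → suc j , q , x })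
    (λ { (zero , refl , x) → inj₁ x ; (suc j , q , x) → inj₂ (j , q , x) })
    (λ { (zero , refl , x) → refl ; (suc j , q , x) → refl })
    (λ { (inj₁ x) → refl ; (inj₂ (j , q , x)) → refl }))
card-∈ (false ∷ p) {f = f} e rewrite sumOver-∷ false p f =
  ↔-trans (card-∈ p (e ∘ suc)) (mk↔ₛ′
    (λ { (j , q , x) → suc j , q , x })
    (λ { (suc j , q , x) → j , q , x })
    (λ { (suc j , q , x) → refl })
    (λ { (j , q , x) → refl }))

-- A first part that is zero or a successor gives the two summands in the recursion of `conv`.
card-Split : ∀ {P Q : ℕ → Set} {f g : ℕ → ℕ} → (∀ a → Fin (f a) ↔ P a) → (∀ b → Fin (g b) ↔ Q b) →
  ∀ k → Fin (conv f g k) ↔ (Σ[ s ∈ Split k ] (P (proj₁ s) × Q (proj₁ (proj₂ s))))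
card-Split d e zero    = ↔-trans (↔-trans *↔× (d 0 ×-↔ e 0)) (mk↔ₛ′
  (λ { (x , y) → (0 , 0 , refl) , x , y })
  (λ { ((zero , zero , refl) , x , y) → x , y })
  (λ { ((zero , zero , refl) , x , y) → refl })
  (λ { (x , y) → refl }))
card-Split d e (suc k) =
  ↔-trans (↔-trans +↔⊎ (↔-trans *↔× (d 0 ×-↔ e (suc k)) ⊎-↔ card-Split (d ∘ suc) e k)) (mk↔ₛ′
    (λ { (inj₁ (x , y)) → (0 , suc k , refl) , x , y
       ; (inj₂ ((a , b , refl) , x , y)) → (suc a , b , refl) , x , y })
    (λ { ((zero , .(suc k) , refl) , x , y) → inj₁ (x , y)
       ; ((suc a , b , refl) , x , y) → inj₂ ((a , b , refl) , x , y) })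
    (λ { ((zero , .(suc k) , refl) , x , y) → refl
       ; ((suc a , b , refl) , x , y) → refl })
    (λ { (inj₁ (x , y)) → refl
       ; (inj₂ ((a , b , refl) , x , y)) → refl }))

-- The recurrence for the numbers of colored trees

-- A row is a Boolean vector, hence a `Subset` of the colors, and this is the n-th coefficient of
-- Σ_j a_ij T_j.
rowSum : ∀ {m} → ColoringMatrix m → Fin m → ℕ → ℕ
rowSum A i n = sumOver (lookup A i) (λ j → t A j n)

-- Removes the root; `finite-↔` keeps the cardinality, so `t A i (suc k)` reduces to that of the
-- forests.
card-ColoredForest : ∀ {m} (A : ColoringMatrix m) i k → Fin (t A i (suc k)) ↔ ColoredForest A i k
card-ColoredForest A i k = proj₂ (finite-ColoredForest A k i)

t-one : ∀ {m} (A : ColoringMatrix m) i → t A i 1 ≡ 1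
t-one A i = Fin↔-unique (card-ColoredForest A i 0) (↔-trans 1↔⊤ (forest-zero A i))

-- The coefficient of x^(k+2) in the equation for T_i. Both factors start in degree 1, hence the
-- shifts: the first subtree has a + 1 vertices, the rest with the root b + 1, and a + b = k.
t-suc-suc : ∀ {m} (A : ColoringMatrix m) i k →
  t A i (suc (suc k)) ≡ conv (rowSum A i ∘ suc) (t A i ∘ suc) k
t-suc-suc A i k = Fin↔-unique (card-ColoredForest A i (suc k))
  (↔-trans (card-Split (λ a → card-∈ (lookup A i) (λ j → card-ColoredForest A j a)) (card-ColoredForest A i) k)
    (↔-trans (mk↔ₛ′
      (λ { (s , (j , e , x) , y) → s , j , e , x , y })
      (λ { (s , j , e , x , y) → s , (j , e , x) , y })
      (λ _ → refl) (λ _ → refl))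
    (forest-suc A i k)))

-- Equivalence of matrices

module _ {m} {A B : ColoringMatrix m} (A~B : StrictlyTreeColoringEquivalent A B) where

  t-cong : ∀ i n → t A i n ≡ t B i n
  t-cong i zero    = refl
  t-cong i (suc n) = A~B (suc n) (s≤s z≤n) i

  rowSum-suc-cong : ∀ i k → rowSum A i (suc k) ≡ rowSum B i (suc k)
  rowSum-suc-cong i = conv-cancelʳ (t-one B i) λ k → begin
    conv (rowSum A i ∘ suc) (t B i ∘ suc) k  ≡⟨ conv-cong k (λ _ _ → refl) (λ b _ → t-cong i (suc b)) ⟨
    conv (rowSum A i ∘ suc) (t A i ∘ suc) k  ≡⟨ t-suc-suc A i k ⟨
    t A i (suc (suc k))                      ≡⟨ t-cong i (suc (suc k)) ⟩
    t B i (suc (suc k))                      ≡⟨ t-suc-suc B i k ⟩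
    conv (rowSum B i ∘ suc) (t B i ∘ suc) k  ∎
    where open ≡-Reasoning

  -- The rows of `A` and `B` are now compared on one family, the counts of `A`, as an operation on
  -- `A` demands.
  selected-sums : ∀ i k → sumOver (lookup A i) (λ j → t A j (suc k)) ≡ sumOver (lookup B i) (λ j → t A j (suc k))
  selected-sums i k = trans (rowSum-suc-cong i k)
    (sumOver-cong (lookup B i) (λ j → sym (t-cong j (suc k))))

  -- Strong induction for all colors at once: the count at size k + 2 depends only on counts at
  -- sizes up to k + 1.
  rowMixture-equivalent : ∀ {C} → (∀ i → lookup C i ≡ lookup A i ⊎ lookup C i ≡ lookup B i) →
    StrictlyTreeColoringEquivalent A C
  rowMixture-equivalent {C} rows (suc n) _ i = <-rec (λ k → ∀ i → t A i (suc k) ≡ t C i (suc k)) step n i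
    where
    step : ∀ k → (∀ {l} → l < k → ∀ i → t A i (suc l) ≡ t C i (suc l)) →
           ∀ i → t A i (suc k) ≡ t C i (suc k)
    step zero    _   i = trans (t-one A i) (sym (t-one C i))
    step (suc k) rec i = begin
      t A i (suc (suc k))                      ≡⟨ t-suc-suc A i k ⟩
      conv (rowSum A i ∘ suc) (t A i ∘ suc) k  ≡⟨ conv-cong k rowSums (λ b b≤k → rec (s≤s b≤k) i) ⟩
      conv (rowSum C i ∘ suc) (t C i ∘ suc) k  ≡⟨ t-suc-suc C i k ⟨
      t C i (suc (suc k))                      ∎
      where
      open ≡-Reasoning

      fromRow : ∀ a → lookup C i ≡ lookup A i ⊎ lookup C i ≡ lookup B i →
        rowSum A i (suc a) ≡ sumOver (lookup C i) (λ j → t A j (suc a))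
      fromRow a (inj₁ eq) rewrite eq = refl
      fromRow a (inj₂ eq) rewrite eq = selected-sums i a

      rowSums : ∀ a → a ≤ k → rowSum A i (suc a) ≡ rowSum C i (suc a)
      -- First the row is changed with the counts of `A` kept, then the induction hypothesis changes
      -- the counts.
      rowSums a a≤k = trans (fromRow a (rows i)) (sumOver-cong (lookup C i) (rec (s≤s a≤k)))

  rowReplacement : ∀ ℓ → (∀ p → p ≢ ℓ → lookup B p ≡ lookup A p) → Operation A B
  rowReplacement ℓ agree = record
    { I             = b ∖ a
    ; J             = a ∖ b
    ; disjoint      = λ { (x , x∈) → let x∈I , x∈J = x∈p∩q⁻ (b ∖ a) (a ∖ b) x∈ in
                          x∈p∖q⇒x∉q b a x∈I (p∖q⊆p a b x∈J) }
    ; ∣I∣≡∣J∣       = ∣I∣≡∣J∣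
    ; sums          = sums
    ; ℓ             = ℓ
    ; C-on-I        = λ i i∈I → ∉⇒lookup≡false (x∈p∖q⇒x∉q b a i∈I)
    ; C-on-J        = λ j j∈J → []=⇒lookup (p∖q⊆p a b j∈J)
    ; C′-on-I       = λ i i∈I → []=⇒lookup (p∖q⊆p b a i∈I)
    ; C′-on-J       = λ j j∈J → ∉⇒lookup≡false (x∈p∖q⇒x∉q a b j∈J)
    ; other-rows    = λ p q p≢ℓ → cong (λ row → lookup row q) (agree p p≢ℓ)
    ; other-columns = lookup-∖-agree a b
    }
    where
    a b : Subset m
    a = lookup A ℓ
    b = lookup B ℓ

    sums-suc : ∀ k → sumOver (b ∖ a) (λ i → t A i (suc k)) ≡ sumOver (a ∖ b) (λ j → t A j (suc k))
    sums-suc k = sumOver-∖ a b _ (selected-sums ℓ k)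

    sumOver-t-one : ∀ (p : Subset m) → sumOver p (λ i → t A i 1) ≡ ∣ p ∣
    sumOver-t-one p = trans (sumOver-cong p (t-one A)) (trans (sumOver-const p 1) (*-identityʳ ∣ p ∣))

    ∣I∣≡∣J∣ : ∣ b ∖ a ∣ ≡ ∣ a ∖ b ∣
    ∣I∣≡∣J∣ = trans (sym (sumOver-t-one (b ∖ a))) (trans (sums-suc 0) (sumOver-t-one (a ∖ b)))

    sums : ∀ n → sumOver (b ∖ a) (λ i → t A i n) ≡ sumOver (a ∖ b) (λ j → t A j n)
    -- Size 0 is outside the equivalence; there every count is 0 by definition.
    sums zero    = trans (sumOver-const (b ∖ a) 0)
      (trans (cong (_* 0) ∣I∣≡∣J∣) (sym (sumOver-const (a ∖ b) 0)))
    sums (suc k) = sums-suc k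

equivalent-sym-trans : ∀ {m} {A C D : ColoringMatrix m} →
  StrictlyTreeColoringEquivalent A C → StrictlyTreeColoringEquivalent A D →
  StrictlyTreeColoringEquivalent C D
equivalent-sym-trans A~C A~D n 1≤n i = trans (sym (A~C n 1≤n i)) (A~D n 1≤n i)

-- Passing from one matrix to the other row by row

lookup-extensional : ∀ {m} {A B : ColoringMatrix m} → (∀ i → lookup A i ≡ lookup B i) → A ≡ B
lookup-extensional {A = A} {B} eq = trans (sym (tabulate∘lookup A)) (trans (tabulate-cong eq) (tabulate∘lookup B))

module _ {m} (A B : ColoringMatrix m) where

  splice : ℕ → ColoringMatrix m
  splice k = tabulate (λ p → if does (toℕ p <? k) then lookup B p else lookup A p)

  splice-< : ∀ k p → toℕ p < k → lookup (splice k) p ≡ lookup B p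
  splice-< k p p<k = trans (lookup∘tabulate _ p)
    (cong (if_then lookup B p else lookup A p) (dec-true (toℕ p <? k) p<k))

  splice-≥ : ∀ k p → k ≤ toℕ p → lookup (splice k) p ≡ lookup A p
  splice-≥ k p k≤p = trans (lookup∘tabulate _ p)
    (cong (if_then lookup B p else lookup A p) (dec-false (toℕ p <? k) (≤⇒≯ k≤p)))

  splice-rows : ∀ k p → lookup (splice k) p ≡ lookup A p ⊎ lookup (splice k) p ≡ lookup B p
  splice-rows k p with toℕ p <? k
  ... | yes p<k = inj₂ (splice-< k p p<k)
  ... | no  p≮k = inj₁ (splice-≥ k p (≮⇒≥ p≮k))

  -- A row other than `ℓ` lies on the same side of the thresholds `toℕ ℓ` and `suc (toℕ ℓ)`.
  splice-suc : ∀ (ℓ p : Fin m) → p ≢ ℓ → lookup (splice (suc (toℕ ℓ))) p ≡ lookup (splice (toℕ ℓ)) p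
  splice-suc ℓ p p≢ℓ with toℕ p <? toℕ ℓ
  ... | yes p<ℓ = trans (splice-< _ p (m<n⇒m<1+n p<ℓ)) (sym (splice-< _ p p<ℓ))
  ... | no  p≮ℓ = trans (splice-≥ _ p (≤∧≢⇒< (≮⇒≥ p≮ℓ) (p≢ℓ ∘ sym ∘ toℕ-injective)))
                        (sym (splice-≥ _ p (≮⇒≥ p≮ℓ)))

  splice-zero : splice 0 ≡ A
  splice-zero = lookup-extensional (λ p → splice-≥ 0 p z≤n)

  splice-all : splice m ≡ B
  splice-all = lookup-extensional (λ p → splice-< m p (toℕ<n p))

  -- Both splices take each row from `A` or `B`, so both are equivalent to `A` and hence to each
  -- other.
  splice-operation : StrictlyTreeColoringEquivalent A B →
    ∀ (ℓ : Fin m) → Operation (splice (toℕ ℓ)) (splice (suc (toℕ ℓ)))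
  splice-operation A~B ℓ = rowReplacement
    (equivalent-sym-trans
      (rowMixture-equivalent A~B (splice-rows (toℕ ℓ)))
      (rowMixture-equivalent A~B (splice-rows (suc (toℕ ℓ)))))
    ℓ (splice-suc ℓ)

-- A row on which A and B already agree gives an operation with I = J = ∅, so exactly m steps do.
theorem19 : ∀ (m : ℕ) (A B : ColoringMatrix m) → A ≢ B → StrictlyTreeColoringEquivalent A B →
    ∃[ r ] (1 ≤ r × Σ[ C ∈ (Fin (suc r) → ColoringMatrix m) ]
    (C zero ≡ A × C (fromℕ r) ≡ B × (∀ (s : Fin r) → Operation (C (inject₁ s)) (C (suc s)))))
-- All matrices of size 0 are equal, so `A ≢ B` excludes this case; otherwise `r = m` is at least 1.
theorem19 zero      [] [] A≢B _   = contradiction refl A≢B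
theorem19 m@(suc _) A  B  _   A~B =
  m , s≤s z≤n , splice A B ∘ toℕ , splice-zero A B ,
  trans (cong (splice A B) (toℕ-fromℕ m)) (splice-all A B) ,
  -- `toℕ (inject₁ s)` equals `toℕ s` only propositionally.
  λ s → subst (λ k → Operation (splice A B k) (splice A B (suc (toℕ s))))
              (sym (toℕ-inject₁ s)) (splice-operation A B A~B s)
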